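{- If $n$ is a non-negative integer and $t$ is any integer, then $$\sum_{k=1}^n(-1)^{k-1}\frac{k}{n+k}\binom{n+k}{n-k}L_{3k+t}=\begin{cases}\frac12L_{t+3}L_n,& n\text{ odd};\\ -\frac52F_{t+3}F_n,& n\text{ even};\end{cases}$$ $$\sum_{k=1}^n(-1)^{k-1}\frac{k}{n+k}\binom{n+k}{n-k}F_{3k+t}=\begin{cases}\frac12F_{t+3}L_n,& n\text{ odd};\\ -\frac12L_{t+3}F_n,& n\text{ even}.\end{cases}$$
   Context: $F_n$ and $L_n$ ($n\in\mathbb{Z}$) are the Fibonacci and Lucas numbers: $F_0=0$, $F_1=1$, $F_n=F_{n-1}+F_{n-2}$; $L_0=2$, $L_1=1$, $L_n=L_{n-1}+L_{n-2}$, extended to negative indices by $F_{ -n}=(-1)^{n-1}F_n$, $L_{ -n}=(-1)^nL_n$. An empty sum is $0$. -}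

module Defs where

open import Data.Nat.Base as ℕ using (ℕ; zero; suc; NonZero)
open import Data.Nat.Combinatorics using (_C_)
open import Data.Nat.Properties as ℕ using ()
open import Data.Integer.Base as ℤ using (ℤ; +_; -[1+_]; -1ℤ)
open import Data.Rational.Base as ℚ using (ℚ; 0ℚ)
open import Relation.Binary.PropositionalEquality using (subst)

fib : ℕ → ℕ
fib 0             = 0
fib 1             = 1
fib (suc (suc n)) = fib (suc n) ℕ.+ fib n

luc : ℕ → ℕ
luc 0             = 2
luc 1             = 1
luc (suc (suc n)) = luc (suc n) ℕ.+ luc n

-- -[1+ m ] is the integer -(m + 1), so the negative clauses are
-- F₋ₙ = (-1)ⁿ⁻¹ Fₙ and L₋ₙ = (-1)ⁿ Lₙ at n = m + 1.

F : ℤ → ℤ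
F (+ n)    = + fib n
F -[1+ m ] = (-1ℤ ℤ.^ m) ℤ.* + fib (suc m)

L : ℤ → ℤ
L (+ n)    = + luc n
L -[1+ m ] = (-1ℤ ℤ.^ suc m) ℤ.* + luc (suc m)

fromℤ : ℤ → ℚ
fromℤ i = i ℚ./ 1

-- Σ[1⋯ n ] f is f 1 + f 2 + ⋯ + f n.  The summand receives the fact
-- that its index is nonzero, so that it may divide by n + k.

Σ[1⋯_] : ℕ → ((k : ℕ) → .{{NonZero k}} → ℚ) → ℚ
Σ[1⋯ zero  ] f = 0ℚ
Σ[1⋯ suc n ] f = Σ[1⋯ n ] f ℚ.+ f (suc n)

n+k≢0 : ∀ n k → .{{NonZero k}} → NonZero (n ℕ.+ k)
n+k≢0 n (suc k) = subst NonZero (ℕ.+-comm (suc k) n) _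

coefficient : (n k : ℕ) → .{{NonZero k}} → ℚ
coefficient n k =
  fromℤ (-1ℤ ℤ.^ (k ℕ.∸ 1)) ℚ.* (+ k ℚ./ (n ℕ.+ k)) ℚ.* fromℤ (+ ((n ℕ.+ k) C (n ℕ.∸ k)))
  where instance _ = n+k≢0 n k

{-# OPTIONS --safe #-}

-- By absorption, k / (n + k) · C (n + k) (n - k) = ½ C (n + k - 1) (2k - 1), so the
-- two sums are ½ T n g and ½ T n h, where T n f = Σ_{k < n} (-1)ᵏ C (n + k) (2k + 1) f k,
-- g k = F (3k + 3 + t) and h k = L (3k + 3 + t).  Pascal's rule gives
-- T (n + 2) f = 2 T (n + 1) f - T n f - T (n + 1) (f ∘ suc).  Since F (m + 3) = 2 F m + L m
-- and L (m + 3) = 2 L m + 5 F m, this becomes T (n + 2) g = - T (n + 1) h - T n g and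
-- T (n + 2) h = - 5 T (n + 1) g - T n h, which the closed forms also satisfy.

module Submission where

open import Defs
open import Data.Nat.Base as ℕ using (ℕ; zero; suc; _<_; s≤s)
import Data.Nat.Properties as ℕ
open import Data.Nat.Combinatorics
  using (_C_; nC1≡n; nCk≡nC[n∸k]; k>n⇒nCk≡0; nCk+nC[k+1]≡[n+1]C[k+1])
open import Data.Nat.Divisibility using (_∣_; _∤_; ∣m∣n⇒∣m+n; ∣m+n∣m⇒∣n; ∣-refl; _∣0; ∣1⇒≡1)
import Data.Nat.Tactic.RingSolver as ℕ-Ring
open import Data.Integer.Base as ℤ using (ℤ; +_; -[1+_]; -1ℤ; 0ℤ)
import Data.Integer.Properties as ℤ
import Data.Integer.Tactic.RingSolver as ℤ-Ring
open import Data.Rational.Base using (ℚ; _*_; _/_; ½; -½; fromℚᵘ)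
import Data.Rational.Base as ℚ
import Data.Rational.Properties as ℚ
open import Data.Rational.Unnormalised.Base as ℚᵘ using (mkℚᵘ; *≡*)
import Data.Rational.Unnormalised.Properties as ℚᵘ
open import Data.List.Base using ([]; _∷_)
open import Data.Product.Base using (_×_; _,_; proj₁; proj₂)
open import Function.Base using (_∘_)
open import Relation.Nullary using (contradiction)
open import Relation.Binary.PropositionalEquality
  using (_≡_; refl; sym; trans; cong; cong₂; subst; module ≡-Reasoning)

open ≡-Reasoning

-- Binomial coefficients

-- Absorption with the division cleared. Pascal's rule splits the upper coefficient, the inductive
-- cases `k` and `suc k` then share the factor `suc n`, and Pascal's rule recombines them. The copy
-- of `b` kept aside raises `suc n` to `suc (suc n)`.
[1+k]*[1+n]C[1+k]≡[1+n]*nCk : ∀ n k → suc k ℕ.* (suc n C suc k) ≡ suc n ℕ.* (n C k)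
[1+k]*[1+n]C[1+k]≡[1+n]*nCk zero    zero    = refl
[1+k]*[1+n]C[1+k]≡[1+n]*nCk zero    (suc k) = begin
  suc (suc k) ℕ.* (1 C suc (suc k)) ≡⟨ cong (suc (suc k) ℕ.*_) (k>n⇒nCk≡0 {1} (s≤s (s≤s (ℕ.z≤n {k})))) ⟩
  suc (suc k) ℕ.* 0                 ≡⟨ ℕ.*-zeroʳ (suc (suc k)) ⟩
  0                                 ≡⟨ cong (1 ℕ.*_) (k>n⇒nCk≡0 {0} (s≤s (ℕ.z≤n {k}))) ⟨
  1 ℕ.* (0 C suc k)                 ∎
[1+k]*[1+n]C[1+k]≡[1+n]*nCk (suc n) zero    = begin
  1 ℕ.* (suc (suc n) C 1)   ≡⟨ cong (1 ℕ.*_) (nC1≡n (suc (suc n))) ⟩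
  1 ℕ.* suc (suc n)         ≡⟨ ℕ.*-comm 1 (suc (suc n)) ⟩
  suc (suc n) ℕ.* (suc n C 0) ∎
[1+k]*[1+n]C[1+k]≡[1+n]*nCk (suc n) (suc k) = begin
  suc (suc k) ℕ.* (suc (suc n) C suc (suc k))
    ≡⟨ cong (suc (suc k) ℕ.*_) (nCk+nC[k+1]≡[n+1]C[k+1] (suc n) (suc k)) ⟨
  suc (suc k) ℕ.* (b ℕ.+ (suc n C suc (suc k)))
    ≡⟨ ℕ.*-distribˡ-+ (suc (suc k)) b _ ⟩
  (b ℕ.+ suc k ℕ.* b) ℕ.+ suc (suc k) ℕ.* (suc n C suc (suc k))
    ≡⟨ cong₂ (λ x y → (b ℕ.+ x) ℕ.+ y)
         ([1+k]*[1+n]C[1+k]≡[1+n]*nCk n k) ([1+k]*[1+n]C[1+k]≡[1+n]*nCk n (suc k)) ⟩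
  (b ℕ.+ suc n ℕ.* (n C k)) ℕ.+ suc n ℕ.* (n C suc k)
    ≡⟨ ℕ.+-assoc b _ _ ⟩
  b ℕ.+ (suc n ℕ.* (n C k) ℕ.+ suc n ℕ.* (n C suc k))
    ≡⟨ cong (b ℕ.+_) (ℕ.*-distribˡ-+ (suc n) (n C k) (n C suc k)) ⟨
  b ℕ.+ suc n ℕ.* ((n C k) ℕ.+ (n C suc k))
    ≡⟨ cong (λ x → b ℕ.+ suc n ℕ.* x) (nCk+nC[k+1]≡[n+1]C[k+1] n k) ⟩
  suc (suc n) ℕ.* b ∎
  where
  b = suc n C suc k

-- Finite sums

∑< : ℕ → (ℕ → ℤ) → ℤ
∑< zero    f = 0ℤ
∑< (suc n) f = ∑< n f ℤ.+ f n

∑<-cong : ∀ n {f g : ℕ → ℤ} → (∀ k → f k ≡ g k) → ∑< n f ≡ ∑< n g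
∑<-cong zero    eq = refl
∑<-cong (suc n) eq = cong₂ ℤ._+_ (∑<-cong n eq) (eq n)

-- Sums and differences of sequences both go through this one form, whence the explicit factors
-- `+ 1` and `-1ℤ` in its uses.
∑<-linear : ∀ a b n f g →
  ∑< n (λ k → a ℤ.* f k ℤ.+ b ℤ.* g k) ≡ a ℤ.* ∑< n f ℤ.+ b ℤ.* ∑< n g
∑<-linear a b zero    f g = ℤ-Ring.solve (a ∷ b ∷ [])
∑<-linear a b (suc n) f g =
  trans (cong (ℤ._+ (a ℤ.* f n ℤ.+ b ℤ.* g n)) (∑<-linear a b n f g)) (lemma a b (∑< n f) (f n) (∑< n g) (g n))
  where
  lemma : ∀ a b x y z w → (a ℤ.* x ℤ.+ b ℤ.* z) ℤ.+ (a ℤ.* y ℤ.+ b ℤ.* w)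
                        ≡ a ℤ.* (x ℤ.+ y) ℤ.+ b ℤ.* (z ℤ.+ w)
  lemma = ℤ-Ring.solve-∀

∑<-head : ∀ n f → ∑< (suc n) f ≡ f 0 ℤ.+ ∑< n (f ∘ suc)
∑<-head zero    f = ℤ.+-comm 0ℤ (f 0)
∑<-head (suc n) f =
  trans (cong (ℤ._+ f (suc n)) (∑<-head n f)) (ℤ.+-assoc (f 0) _ _)

∑<-last≡0 : ∀ n f → f n ≡ 0ℤ → ∑< (suc n) f ≡ ∑< n f
∑<-last≡0 n f eq = trans (cong (λ z → ∑< n f ℤ.+ z) eq) (ℤ.+-identityʳ _)

-- The binomial transforms

term : (ℕ → ℕ) → (ℕ → ℤ) → ℕ → ℤ
term c g k = -1ℤ ℤ.^ k ℤ.* + c k ℤ.* g k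

term≡0 : ∀ c g k → c k ≡ 0 → term c g k ≡ 0ℤ
term≡0 c g k eq = begin
  -1ℤ ℤ.^ k ℤ.* + c k ℤ.* g k ≡⟨ cong (λ x → -1ℤ ℤ.^ k ℤ.* + x ℤ.* g k) eq ⟩
  -1ℤ ℤ.^ k ℤ.* 0ℤ ℤ.* g k    ≡⟨ lemma (-1ℤ ℤ.^ k) (g k) ⟩
  0ℤ                          ∎
  where
  lemma : ∀ s x → s ℤ.* 0ℤ ℤ.* x ≡ 0ℤ
  lemma = ℤ-Ring.solve-∀

odd-C even-C : ℕ → ℕ → ℕ
odd-C  n k = (n ℕ.+ k) C suc (2 ℕ.* k)
even-C n k = (n ℕ.+ k) C (2 ℕ.* k)

-- At `g k` = xᵏ these are Morgan-Voyce polynomials: `E n g` is bₙ(-x) and `T (suc n) g` is Bₙ(-x).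
-- `E` includes k = n because C (2n) (2n) = 1, while `T` stops before it because C (2n) (2n + 1) =
-- 0.
T E : ℕ → (ℕ → ℤ) → ℤ
T n g = ∑< n (term (odd-C n) g)
E n g = ∑< (suc n) (term (even-C n) g)

-- Pascal's rule in each term: C (n + 1 + k) (2k + 1) = C (n + k) (2k) + C (n + k) (2k + 1).
T-suc : ∀ n g → T (suc n) g ≡ T n g ℤ.+ E n g
T-suc n g = begin
  T (suc n) g
    ≡⟨ ∑<-cong (suc n) pascal ⟩
  ∑< (suc n) (λ k → + 1 ℤ.* t k ℤ.+ + 1 ℤ.* e k)
    ≡⟨ ∑<-linear (+ 1) (+ 1) (suc n) t e ⟩
  + 1 ℤ.* ∑< (suc n) t ℤ.+ + 1 ℤ.* E n g
    ≡⟨ cong₂ ℤ._+_ (ℤ.*-identityˡ (∑< (suc n) t)) (ℤ.*-identityˡ (E n g)) ⟩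
  ∑< (suc n) t ℤ.+ E n g
    ≡⟨ cong (ℤ._+ E n g) (∑<-last≡0 n t (term≡0 (odd-C n) g n (k>n⇒nCk≡0 n+n<1+2n))) ⟩
  T n g ℤ.+ E n g ∎
  where
  t = term (odd-C n) g
  e = term (even-C n) g
  n+n<1+2n : n ℕ.+ n < suc (2 ℕ.* n)
  n+n<1+2n = s≤s (ℕ.≤-reflexive (cong (n ℕ.+_) (sym (ℕ.+-identityʳ n))))
  lemma : ∀ s x y z → s ℤ.* (x ℤ.+ y) ℤ.* z
                    ≡ + 1 ℤ.* (s ℤ.* y ℤ.* z) ℤ.+ + 1 ℤ.* (s ℤ.* x ℤ.* z)
  lemma = ℤ-Ring.solve-∀
  pascal : ∀ k → term (odd-C (suc n)) g k ≡ + 1 ℤ.* t k ℤ.+ + 1 ℤ.* e k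
  pascal k = trans
    (cong (λ x → -1ℤ ℤ.^ k ℤ.* + x ℤ.* g k)
      (sym (nCk+nC[k+1]≡[n+1]C[k+1] (n ℕ.+ k) (2 ℕ.* k))))
    (lemma (-1ℤ ℤ.^ k) (+ even-C n k) (+ odd-C n k) (g k))

-- Pascal's rule at index k + 1 splits off C (n + 1 + k) (2k + 1), an odd coefficient at k that
-- still multiplies `g (suc k)`. Hence the shifted sequence, and a minus sign from the power of -1.
E-suc : ∀ n g → E (suc n) g ≡ E n g ℤ.- T (suc n) (g ∘ suc)
E-suc n g = begin
  E (suc n) g
    ≡⟨ ∑<-head (suc n) (term (even-C (suc n)) g) ⟩
  -- At k = 0 the coefficients `even-C (suc n)` and `even-C n` are both 1, so the head is already a
  -- term of `E n g`.
  e 0 ℤ.+ ∑< (suc n) (term (even-C (suc n)) g ∘ suc)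
    ≡⟨ cong (λ z → e 0 ℤ.+ z) (∑<-cong (suc n) pascal) ⟩
  e 0 ℤ.+ ∑< (suc n) (λ k → + 1 ℤ.* e (suc k) ℤ.+ -1ℤ ℤ.* t k)
    ≡⟨ cong (λ z → e 0 ℤ.+ z) (∑<-linear (+ 1) -1ℤ (suc n) (e ∘ suc) t) ⟩
  e 0 ℤ.+ (+ 1 ℤ.* ∑< (suc n) (e ∘ suc) ℤ.+ -1ℤ ℤ.* T (suc n) (g ∘ suc))
    ≡⟨ regroup (e 0) (∑< (suc n) (e ∘ suc)) (T (suc n) (g ∘ suc)) ⟩
  (e 0 ℤ.+ ∑< (suc n) (e ∘ suc)) ℤ.- T (suc n) (g ∘ suc)
    ≡⟨ cong (ℤ._- T (suc n) (g ∘ suc)) (∑<-head (suc n) e) ⟨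
  ∑< (suc (suc n)) e ℤ.- T (suc n) (g ∘ suc)
    -- The index k = n + 1 contributes C (2n + 1) (2n + 2) = 0.
    ≡⟨ cong (ℤ._- T (suc n) (g ∘ suc))
         (∑<-last≡0 (suc n) e (term≡0 (even-C n) g (suc n) (k>n⇒nCk≡0 n+[1+n]<2[1+n]))) ⟩
  E n g ℤ.- T (suc n) (g ∘ suc) ∎
  where
  e = term (even-C n) g
  t = term (odd-C (suc n)) (g ∘ suc)
  n+[1+n]<2[1+n] : n ℕ.+ suc n < 2 ℕ.* suc n
  n+[1+n]<2[1+n] = s≤s (ℕ.≤-reflexive (cong (n ℕ.+_) (sym (ℕ.+-identityʳ (suc n)))))
  regroup : ∀ x y z → x ℤ.+ (+ 1 ℤ.* y ℤ.+ -1ℤ ℤ.* z) ≡ (x ℤ.+ y) ℤ.- z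
  regroup = ℤ-Ring.solve-∀
  lemma : ∀ s x y z → (-1ℤ ℤ.* s) ℤ.* (x ℤ.+ y) ℤ.* z
                    ≡ + 1 ℤ.* ((-1ℤ ℤ.* s) ℤ.* y ℤ.* z) ℤ.+ -1ℤ ℤ.* (s ℤ.* x ℤ.* z)
  lemma = ℤ-Ring.solve-∀
  even-pascal : ∀ k → even-C (suc n) (suc k) ≡ odd-C (suc n) k ℕ.+ even-C n (suc k)
  even-pascal k = begin
    suc (n ℕ.+ suc k) C (2 ℕ.* suc k)
      ≡⟨ cong (suc (n ℕ.+ suc k) C_) (ℕ.*-suc 2 k) ⟩
    suc (n ℕ.+ suc k) C suc (suc (2 ℕ.* k))
      ≡⟨ nCk+nC[k+1]≡[n+1]C[k+1] (n ℕ.+ suc k) (suc (2 ℕ.* k)) ⟨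
    ((n ℕ.+ suc k) C suc (2 ℕ.* k)) ℕ.+ ((n ℕ.+ suc k) C suc (suc (2 ℕ.* k)))
      ≡⟨ cong₂ (λ i j → (i C suc (2 ℕ.* k)) ℕ.+ ((n ℕ.+ suc k) C j))
           (ℕ.+-suc n k) (sym (ℕ.*-suc 2 k)) ⟩
    odd-C (suc n) k ℕ.+ even-C n (suc k) ∎
  pascal : ∀ k → term (even-C (suc n)) g (suc k) ≡ + 1 ℤ.* e (suc k) ℤ.+ -1ℤ ℤ.* t k
  pascal k = trans
    (cong (λ x → -1ℤ ℤ.^ suc k ℤ.* + x ℤ.* g (suc k)) (even-pascal k))
    (lemma (-1ℤ ℤ.^ k) (+ odd-C (suc n) k) (+ even-C n (suc k)) (g (suc k)))

-- Eliminating `E` from the two Pascal relations: the second difference of `T` in `n` is minus the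
-- transform of the shifted sequence.
T-recurrence : ∀ n g →
  T (suc (suc n)) g ≡ + 2 ℤ.* T (suc n) g ℤ.- T n g ℤ.- T (suc n) (g ∘ suc)
T-recurrence n g = begin
  T (suc (suc n)) g
    ≡⟨ T-suc (suc n) g ⟩
  T (suc n) g ℤ.+ E (suc n) g
    ≡⟨ cong₂ ℤ._+_ (T-suc n g) (E-suc n g) ⟩
  (T n g ℤ.+ E n g) ℤ.+ (E n g ℤ.- T (suc n) (g ∘ suc))
    ≡⟨ lemma (T n g) (E n g) (T (suc n) (g ∘ suc)) ⟩
  + 2 ℤ.* (T n g ℤ.+ E n g) ℤ.- T n g ℤ.- T (suc n) (g ∘ suc)
    ≡⟨ cong (λ x → + 2 ℤ.* x ℤ.- T n g ℤ.- T (suc n) (g ∘ suc)) (T-suc n g) ⟨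
  + 2 ℤ.* T (suc n) g ℤ.- T n g ℤ.- T (suc n) (g ∘ suc) ∎
  where
  lemma : ∀ t e s → (t ℤ.+ e) ℤ.+ (e ℤ.- s) ≡ + 2 ℤ.* (t ℤ.+ e) ℤ.- t ℤ.- s
  lemma = ℤ-Ring.solve-∀

T-linear : ∀ a b n g h →
  T n (λ k → a ℤ.* g k ℤ.+ b ℤ.* h k) ≡ a ℤ.* T n g ℤ.+ b ℤ.* T n h
T-linear a b n g h = trans
  (∑<-cong n λ k → lemma a b (-1ℤ ℤ.^ k ℤ.* + odd-C n k) (g k) (h k))
  (∑<-linear a b n (term (odd-C n) g) (term (odd-C n) h))
  where
  lemma : ∀ a b c x y → c ℤ.* (a ℤ.* x ℤ.+ b ℤ.* y) ≡ a ℤ.* (c ℤ.* x) ℤ.+ b ℤ.* (c ℤ.* y)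
  lemma = ℤ-Ring.solve-∀

-- Fibonacci and Lucas numbers

-- With φ the golden ratio, φⁿ = (Lₙ + Fₙ√5)/2. This identity and `2luc≡5fib+luc` are the two
-- coordinates of φⁿ⁺¹ = φ · φⁿ.
fib+luc≡2fib : ∀ n → fib n ℕ.+ luc n ≡ 2 ℕ.* fib (suc n)
fib+luc≡2fib 0             = refl
fib+luc≡2fib 1             = refl
fib+luc≡2fib (suc (suc n)) = begin
  (fib (suc n) ℕ.+ fib n) ℕ.+ (luc (suc n) ℕ.+ luc n)
    ≡⟨ lemma (fib (suc n)) (fib n) (luc (suc n)) (luc n) ⟩
  (fib (suc n) ℕ.+ luc (suc n)) ℕ.+ (fib n ℕ.+ luc n)
    ≡⟨ cong₂ ℕ._+_ (fib+luc≡2fib (suc n)) (fib+luc≡2fib n) ⟩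
  2 ℕ.* fib (suc (suc n)) ℕ.+ 2 ℕ.* fib (suc n)
    ≡⟨ ℕ.*-distribˡ-+ 2 (fib (suc (suc n))) (fib (suc n)) ⟨
  2 ℕ.* fib (suc (suc (suc n))) ∎
  where
  lemma : ∀ a b c d → (a ℕ.+ b) ℕ.+ (c ℕ.+ d) ≡ (a ℕ.+ c) ℕ.+ (b ℕ.+ d)
  lemma = ℕ-Ring.solve-∀

-- Together with `5fib≡luc+2luc` this is the backward step, division by φ. It serves the negative
-- indices and the closed forms.
luc≡fib+2fib : ∀ n → luc (suc n) ≡ fib (suc n) ℕ.+ 2 ℕ.* fib n
luc≡fib+2fib 0             = refl
luc≡fib+2fib 1             = refl
luc≡fib+2fib (suc (suc n)) = begin
  luc (suc (suc n)) ℕ.+ luc (suc n)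
    ≡⟨ cong₂ ℕ._+_ (luc≡fib+2fib (suc n)) (luc≡fib+2fib n) ⟩
  (fib (suc (suc n)) ℕ.+ 2 ℕ.* fib (suc n)) ℕ.+ (fib (suc n) ℕ.+ 2 ℕ.* fib n)
    ≡⟨ lemma (fib (suc (suc n))) (fib (suc n)) (fib n) ⟩
  fib (suc (suc (suc n))) ℕ.+ 2 ℕ.* fib (suc (suc n)) ∎
  where
  lemma : ∀ x a b → (x ℕ.+ 2 ℕ.* a) ℕ.+ (a ℕ.+ 2 ℕ.* b) ≡ (x ℕ.+ a) ℕ.+ 2 ℕ.* (a ℕ.+ b)
  lemma = ℕ-Ring.solve-∀

2luc≡5fib+luc : ∀ n → 2 ℕ.* luc (suc n) ≡ 5 ℕ.* fib n ℕ.+ luc n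
2luc≡5fib+luc n = begin
  2 ℕ.* luc (suc n)                       ≡⟨ cong (2 ℕ.*_) (luc≡fib+2fib n) ⟩
  2 ℕ.* (fib (suc n) ℕ.+ 2 ℕ.* fib n)     ≡⟨ lemma₁ (fib (suc n)) (fib n) ⟩
  2 ℕ.* fib (suc n) ℕ.+ 4 ℕ.* fib n       ≡⟨ cong (ℕ._+ 4 ℕ.* fib n) (fib+luc≡2fib n) ⟨
  (fib n ℕ.+ luc n) ℕ.+ 4 ℕ.* fib n       ≡⟨ lemma₂ (fib n) (luc n) ⟩
  5 ℕ.* fib n ℕ.+ luc n                   ∎
  where
  lemma₁ : ∀ x y → 2 ℕ.* (x ℕ.+ 2 ℕ.* y) ≡ 2 ℕ.* x ℕ.+ 4 ℕ.* y
  lemma₁ = ℕ-Ring.solve-∀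
  lemma₂ : ∀ x y → (x ℕ.+ y) ℕ.+ 4 ℕ.* x ≡ 5 ℕ.* x ℕ.+ y
  lemma₂ = ℕ-Ring.solve-∀

5fib≡luc+2luc : ∀ n → 5 ℕ.* fib (suc n) ≡ luc (suc n) ℕ.+ 2 ℕ.* luc n
5fib≡luc+2luc 0             = refl
5fib≡luc+2luc 1             = refl
5fib≡luc+2luc (suc (suc n)) = begin
  5 ℕ.* (fib (suc (suc n)) ℕ.+ fib (suc n))
    ≡⟨ ℕ.*-distribˡ-+ 5 (fib (suc (suc n))) (fib (suc n)) ⟩
  5 ℕ.* fib (suc (suc n)) ℕ.+ 5 ℕ.* fib (suc n)
    ≡⟨ cong₂ ℕ._+_ (5fib≡luc+2luc (suc n)) (5fib≡luc+2luc n) ⟩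
  (luc (suc (suc n)) ℕ.+ 2 ℕ.* luc (suc n)) ℕ.+ (luc (suc n) ℕ.+ 2 ℕ.* luc n)
    ≡⟨ lemma (luc (suc (suc n))) (luc (suc n)) (luc n) ⟩
  luc (suc (suc (suc n))) ℕ.+ 2 ℕ.* luc (suc (suc n)) ∎
  where
  lemma : ∀ x a b → (x ℕ.+ 2 ℕ.* a) ℕ.+ (a ℕ.+ 2 ℕ.* b) ≡ (x ℕ.+ a) ℕ.+ 2 ℕ.* (a ℕ.+ b)
  lemma = ℕ-Ring.solve-∀

-- Reflection turns the step forward at a negative index into the backward step `luc≡fib+2fib`.
-- Being first order in the pair `F`, `L`, the step crosses between the defining clauses only at i =
-- -1, where it holds by computation.
2F[1+i]≡F+L : ∀ i → + 2 ℤ.* F (ℤ.suc i) ≡ F i ℤ.+ L i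
2F[1+i]≡F+L (+ n) =
  trans (sym (ℤ.pos-* 2 (fib (suc n)))) (cong +_ (sym (fib+luc≡2fib n)))
2F[1+i]≡F+L -[1+ zero ] = refl
2F[1+i]≡F+L -[1+ suc m ] = begin
  + 2 ℤ.* (s ℤ.* + x)
    ≡⟨ lemma s (+ x) (+ y) ⟩
  (-1ℤ ℤ.* s) ℤ.* + y ℤ.+ (-1ℤ ℤ.* (-1ℤ ℤ.* s)) ℤ.* (+ y ℤ.+ + 2 ℤ.* + x)
    ≡⟨ cong (λ z → (-1ℤ ℤ.* s) ℤ.* + y ℤ.+ (-1ℤ ℤ.* (-1ℤ ℤ.* s)) ℤ.* z)
         (trans (cong (λ z → + y ℤ.+ z) (sym (ℤ.pos-* 2 x))) (cong +_ (sym (luc≡fib+2fib (suc m))))) ⟩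
  (-1ℤ ℤ.* s) ℤ.* + y ℤ.+ (-1ℤ ℤ.* (-1ℤ ℤ.* s)) ℤ.* + luc (suc (suc m)) ∎
  where
  s = -1ℤ ℤ.^ m
  x = fib (suc m)
  y = fib (suc (suc m))
  lemma : ∀ s x y → + 2 ℤ.* (s ℤ.* x)
        ≡ (-1ℤ ℤ.* s) ℤ.* y ℤ.+ (-1ℤ ℤ.* (-1ℤ ℤ.* s)) ℤ.* (y ℤ.+ + 2 ℤ.* x)
  lemma = ℤ-Ring.solve-∀

-- The other coordinate of multiplication by φ; negative indices now rest on `5fib≡luc+2luc`.
2L[1+i]≡5F+L : ∀ i → + 2 ℤ.* L (ℤ.suc i) ≡ + 5 ℤ.* F i ℤ.+ L i
2L[1+i]≡5F+L (+ n) = begin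
  + 2 ℤ.* + luc (suc n)       ≡⟨ ℤ.pos-* 2 (luc (suc n)) ⟨
  + (2 ℕ.* luc (suc n))       ≡⟨ cong +_ (2luc≡5fib+luc n) ⟩
  + (5 ℕ.* fib n ℕ.+ luc n)   ≡⟨ cong (ℤ._+ + luc n) (ℤ.pos-* 5 (fib n)) ⟩
  + 5 ℤ.* + fib n ℤ.+ + luc n ∎
2L[1+i]≡5F+L -[1+ zero ] = refl
2L[1+i]≡5F+L -[1+ suc m ] = begin
  + 2 ℤ.* ((-1ℤ ℤ.* s) ℤ.* + x)
    ≡⟨ lemma s (+ x) (+ y) ⟩
  (-1ℤ ℤ.* s) ℤ.* (+ y ℤ.+ + 2 ℤ.* + x) ℤ.+ (-1ℤ ℤ.* (-1ℤ ℤ.* s)) ℤ.* + y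
    ≡⟨ cong (λ z → (-1ℤ ℤ.* s) ℤ.* z ℤ.+ (-1ℤ ℤ.* (-1ℤ ℤ.* s)) ℤ.* + y)
         (trans (cong (λ z → + y ℤ.+ z) (sym (ℤ.pos-* 2 x)))
           (trans (cong +_ (sym (5fib≡luc+2luc (suc m)))) (ℤ.pos-* 5 (fib (suc (suc m)))))) ⟩
  (-1ℤ ℤ.* s) ℤ.* (+ 5 ℤ.* + fib (suc (suc m))) ℤ.+ (-1ℤ ℤ.* (-1ℤ ℤ.* s)) ℤ.* + y
    ≡⟨ swap (-1ℤ ℤ.* s) (+ fib (suc (suc m))) ((-1ℤ ℤ.* (-1ℤ ℤ.* s)) ℤ.* + y) ⟩
  + 5 ℤ.* ((-1ℤ ℤ.* s) ℤ.* + fib (suc (suc m))) ℤ.+ (-1ℤ ℤ.* (-1ℤ ℤ.* s)) ℤ.* + y ∎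
  where
  s = -1ℤ ℤ.^ m
  x = luc (suc m)
  y = luc (suc (suc m))
  lemma : ∀ s x y → + 2 ℤ.* ((-1ℤ ℤ.* s) ℤ.* x)
        ≡ (-1ℤ ℤ.* s) ℤ.* (y ℤ.+ + 2 ℤ.* x) ℤ.+ (-1ℤ ℤ.* (-1ℤ ℤ.* s)) ℤ.* y
  lemma = ℤ-Ring.solve-∀
  swap : ∀ a b c → a ℤ.* (+ 5 ℤ.* b) ℤ.+ c ≡ + 5 ℤ.* (a ℤ.* b) ℤ.+ c
  swap = ℤ-Ring.solve-∀

i+3≡suc³ : ∀ i → i ℤ.+ + 3 ≡ ℤ.suc (ℤ.suc (ℤ.suc i))
i+3≡suc³ = lemma
  where
  lemma : ∀ i → i ℤ.+ + 3 ≡ + 1 ℤ.+ (+ 1 ℤ.+ (+ 1 ℤ.+ i))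
  lemma = ℤ-Ring.solve-∀

-- Multiplication by φ³ = 2 + √5, whose coordinates are integers although those of φ are halves.
-- Three doubled steps produce the factor 8, which is then cancelled.
F[i+3]≡2F+L : ∀ i → F (i ℤ.+ + 3) ≡ + 2 ℤ.* F i ℤ.+ L i
F[i+3]≡2F+L i = ℤ.*-cancelˡ-≡ (+ 8) _ _ (begin
  + 8 ℤ.* F (i ℤ.+ + 3)
    ≡⟨ cong (λ j → + 8 ℤ.* F j) (i+3≡suc³ i) ⟩
  + 8 ℤ.* F i₃
    ≡⟨ ℤ.*-assoc (+ 4) (+ 2) (F i₃) ⟩
  + 4 ℤ.* (+ 2 ℤ.* F i₃)
    ≡⟨ cong (+ 4 ℤ.*_) (2F[1+i]≡F+L i₂) ⟩
  + 4 ℤ.* (F i₂ ℤ.+ L i₂)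
    ≡⟨ lemma₂ (F i₂) (L i₂) ⟩
  + 2 ℤ.* (+ 2 ℤ.* F i₂) ℤ.+ + 2 ℤ.* (+ 2 ℤ.* L i₂)
    ≡⟨ cong₂ (λ x y → + 2 ℤ.* x ℤ.+ + 2 ℤ.* y) (2F[1+i]≡F+L i₁) (2L[1+i]≡5F+L i₁) ⟩
  + 2 ℤ.* (F i₁ ℤ.+ L i₁) ℤ.+ + 2 ℤ.* (+ 5 ℤ.* F i₁ ℤ.+ L i₁)
    ≡⟨ lemma₁ (F i₁) (L i₁) ⟩
  + 6 ℤ.* (+ 2 ℤ.* F i₁) ℤ.+ + 2 ℤ.* (+ 2 ℤ.* L i₁)
    ≡⟨ cong₂ (λ x y → + 6 ℤ.* x ℤ.+ + 2 ℤ.* y) (2F[1+i]≡F+L i) (2L[1+i]≡5F+L i) ⟩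
  + 6 ℤ.* (F i ℤ.+ L i) ℤ.+ + 2 ℤ.* (+ 5 ℤ.* F i ℤ.+ L i)
    ≡⟨ lemma₀ (F i) (L i) ⟩
  + 8 ℤ.* (+ 2 ℤ.* F i ℤ.+ L i) ∎)
  where
  i₁ = ℤ.suc i
  i₂ = ℤ.suc i₁
  i₃ = ℤ.suc i₂
  lemma₂ : ∀ x y → + 4 ℤ.* (x ℤ.+ y) ≡ + 2 ℤ.* (+ 2 ℤ.* x) ℤ.+ + 2 ℤ.* (+ 2 ℤ.* y)
  lemma₂ = ℤ-Ring.solve-∀
  lemma₁ : ∀ x y → + 2 ℤ.* (x ℤ.+ y) ℤ.+ + 2 ℤ.* (+ 5 ℤ.* x ℤ.+ y)
                 ≡ + 6 ℤ.* (+ 2 ℤ.* x) ℤ.+ + 2 ℤ.* (+ 2 ℤ.* y)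
  lemma₁ = ℤ-Ring.solve-∀
  lemma₀ : ∀ x y → + 6 ℤ.* (x ℤ.+ y) ℤ.+ + 2 ℤ.* (+ 5 ℤ.* x ℤ.+ y)
                 ≡ + 8 ℤ.* (+ 2 ℤ.* x ℤ.+ y)
  lemma₀ = ℤ-Ring.solve-∀

-- The rational coordinate of the same product by φ³.
L[i+3]≡2L+5F : ∀ i → L (i ℤ.+ + 3) ≡ + 2 ℤ.* L i ℤ.+ + 5 ℤ.* F i
L[i+3]≡2L+5F i = ℤ.*-cancelˡ-≡ (+ 8) _ _ (begin
  + 8 ℤ.* L (i ℤ.+ + 3)
    ≡⟨ cong (λ j → + 8 ℤ.* L j) (i+3≡suc³ i) ⟩
  + 8 ℤ.* L i₃
    ≡⟨ ℤ.*-assoc (+ 4) (+ 2) (L i₃) ⟩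
  + 4 ℤ.* (+ 2 ℤ.* L i₃)
    ≡⟨ cong (+ 4 ℤ.*_) (2L[1+i]≡5F+L i₂) ⟩
  + 4 ℤ.* (+ 5 ℤ.* F i₂ ℤ.+ L i₂)
    ≡⟨ lemma₂ (F i₂) (L i₂) ⟩
  + 10 ℤ.* (+ 2 ℤ.* F i₂) ℤ.+ + 2 ℤ.* (+ 2 ℤ.* L i₂)
    ≡⟨ cong₂ (λ x y → + 10 ℤ.* x ℤ.+ + 2 ℤ.* y) (2F[1+i]≡F+L i₁) (2L[1+i]≡5F+L i₁) ⟩
  + 10 ℤ.* (F i₁ ℤ.+ L i₁) ℤ.+ + 2 ℤ.* (+ 5 ℤ.* F i₁ ℤ.+ L i₁)
    ≡⟨ lemma₁ (F i₁) (L i₁) ⟩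
  + 10 ℤ.* (+ 2 ℤ.* F i₁) ℤ.+ + 6 ℤ.* (+ 2 ℤ.* L i₁)
    ≡⟨ cong₂ (λ x y → + 10 ℤ.* x ℤ.+ + 6 ℤ.* y) (2F[1+i]≡F+L i) (2L[1+i]≡5F+L i) ⟩
  + 10 ℤ.* (F i ℤ.+ L i) ℤ.+ + 6 ℤ.* (+ 5 ℤ.* F i ℤ.+ L i)
    ≡⟨ lemma₀ (F i) (L i) ⟩
  + 8 ℤ.* (+ 2 ℤ.* L i ℤ.+ + 5 ℤ.* F i) ∎)
  where
  i₁ = ℤ.suc i
  i₂ = ℤ.suc i₁
  i₃ = ℤ.suc i₂
  lemma₂ : ∀ x y → + 4 ℤ.* (+ 5 ℤ.* x ℤ.+ y)
                 ≡ + 10 ℤ.* (+ 2 ℤ.* x) ℤ.+ + 2 ℤ.* (+ 2 ℤ.* y)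
  lemma₂ = ℤ-Ring.solve-∀
  lemma₁ : ∀ x y → + 10 ℤ.* (x ℤ.+ y) ℤ.+ + 2 ℤ.* (+ 5 ℤ.* x ℤ.+ y)
                 ≡ + 10 ℤ.* (+ 2 ℤ.* x) ℤ.+ + 6 ℤ.* (+ 2 ℤ.* y)
  lemma₁ = ℤ-Ring.solve-∀
  lemma₀ : ∀ x y → + 10 ℤ.* (x ℤ.+ y) ℤ.+ + 6 ℤ.* (+ 5 ℤ.* x ℤ.+ y)
                 ≡ + 8 ℤ.* (+ 2 ℤ.* y ℤ.+ + 5 ℤ.* x)
  lemma₀ = ℤ-Ring.solve-∀

-- Closed forms of the transforms

2∤n⇒2∣1+n : ∀ n → 2 ∤ n → 2 ∣ suc n
2∤n⇒2∣1+n 0             2∤0   = contradiction (2 ∣0) 2∤0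
2∤n⇒2∣1+n 1             _     = ∣-refl
2∤n⇒2∣1+n (suc (suc n)) 2∤2+n =
  ∣m∣n⇒∣m+n ∣-refl (2∤n⇒2∣1+n n (2∤2+n ∘ ∣m∣n⇒∣m+n ∣-refl))

2∣1+n⇒2∤n : ∀ n → 2 ∣ suc n → 2 ∤ n
2∣1+n⇒2∤n n 2∣1+n 2∣n =
  contradiction (∣1⇒≡1 (∣m+n∣m⇒∣n (subst (2 ∣_) (ℕ.+-comm 1 n) 2∣1+n) 2∣n)) λ ()

-- For x = φ³ the recurrence of the transforms is uₙ₊₂ = -√5 uₙ₊₁ - uₙ. Its solution from 0, 1 is Lₙ
-- at odd n and -√5 Fₙ at even n. The two forms list the coordinates of uₙ (h 0 + g 0 √5).
OddForm EvenForm : (g h : ℕ → ℤ) → ℕ → Set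
OddForm  g h n = T n g ≡ g 0 ℤ.* + luc n × T n h ≡ h 0 ℤ.* + luc n
EvenForm g h n = T n g ≡ ℤ.- (h 0 ℤ.* + fib n) × T n h ≡ ℤ.- (+ 5 ℤ.* g 0 ℤ.* + fib n)

-- The hypotheses say that h k + g k √5 is multiplied by 2 + √5 at each step.
module _ (g h : ℕ → ℤ)
         (g-suc : ∀ k → g (suc k) ≡ + 2 ℤ.* g k ℤ.+ h k)
         (h-suc : ∀ k → h (suc k) ≡ + 2 ℤ.* h k ℤ.+ + 5 ℤ.* g k) where

  -- The 2 in φ³ = 2 + √5 cancels the 2 of the second difference, so at `suc n` only the transform
  -- of the other sequence survives.
  T-step-g : ∀ n → T (suc (suc n)) g ≡ ℤ.- T (suc n) h ℤ.- T n g
  T-step-g n = begin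
    T (suc (suc n)) g
      ≡⟨ T-recurrence n g ⟩
    + 2 ℤ.* T (suc n) g ℤ.- T n g ℤ.- T (suc n) (g ∘ suc)
      ≡⟨ cong (λ x → + 2 ℤ.* T (suc n) g ℤ.- T n g ℤ.- x)
           (trans (∑<-cong (suc n) λ k → cong (-1ℤ ℤ.^ k ℤ.* + odd-C (suc n) k ℤ.*_)
                     (trans (g-suc k) (cong (λ z → + 2 ℤ.* g k ℤ.+ z) (sym (ℤ.*-identityˡ (h k))))))
             (T-linear (+ 2) (+ 1) (suc n) g h)) ⟩
    + 2 ℤ.* T (suc n) g ℤ.- T n g ℤ.- (+ 2 ℤ.* T (suc n) g ℤ.+ + 1 ℤ.* T (suc n) h)
      ≡⟨ lemma (T (suc n) g) (T n g) (T (suc n) h) ⟩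
    ℤ.- T (suc n) h ℤ.- T n g ∎
    where
    lemma : ∀ x y z → + 2 ℤ.* x ℤ.- y ℤ.- (+ 2 ℤ.* x ℤ.+ + 1 ℤ.* z) ≡ ℤ.- z ℤ.- y
    lemma = ℤ-Ring.solve-∀

  T-step-h : ∀ n → T (suc (suc n)) h ≡ ℤ.- (+ 5 ℤ.* T (suc n) g) ℤ.- T n h
  T-step-h n = begin
    T (suc (suc n)) h
      ≡⟨ T-recurrence n h ⟩
    + 2 ℤ.* T (suc n) h ℤ.- T n h ℤ.- T (suc n) (h ∘ suc)
      ≡⟨ cong (λ x → + 2 ℤ.* T (suc n) h ℤ.- T n h ℤ.- x)
           (trans (∑<-cong (suc n) λ k → cong (-1ℤ ℤ.^ k ℤ.* + odd-C (suc n) k ℤ.*_) (h-suc k))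
             (T-linear (+ 2) (+ 5) (suc n) h g)) ⟩
    + 2 ℤ.* T (suc n) h ℤ.- T n h ℤ.- (+ 2 ℤ.* T (suc n) h ℤ.+ + 5 ℤ.* T (suc n) g)
      ≡⟨ lemma (T (suc n) h) (T n h) (T (suc n) g) ⟩
    ℤ.- (+ 5 ℤ.* T (suc n) g) ℤ.- T n h ∎
    where
    lemma : ∀ x y z → + 2 ℤ.* x ℤ.- y ℤ.- (+ 2 ℤ.* x ℤ.+ + 5 ℤ.* z) ≡ ℤ.- (+ 5 ℤ.* z) ℤ.- y
    lemma = ℤ-Ring.solve-∀

  -- Both components reduce to 5Fₙ₊₁ - Lₙ = Lₙ₊₂.
  odd-step : ∀ n → EvenForm g h (suc n) → OddForm g h n → OddForm g h (suc (suc n))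
  odd-step n (eg , eh) (og , oh) =
    (begin
      T (suc (suc n)) g
        ≡⟨ T-step-g n ⟩
      ℤ.- T (suc n) h ℤ.- T n g
        ≡⟨ cong₂ (λ x y → ℤ.- x ℤ.- y) eh og ⟩
      ℤ.- ℤ.- (+ 5 ℤ.* g 0 ℤ.* + fib (suc n)) ℤ.- g 0 ℤ.* + luc n
        ≡⟨ lemma₁ (g 0) (+ fib (suc n)) (+ luc n) ⟩
      g 0 ℤ.* (+ 5 ℤ.* + fib (suc n) ℤ.- + luc n)
        ≡⟨ cong (g 0 ℤ.*_) 5fib-luc ⟩
      g 0 ℤ.* + luc (suc (suc n)) ∎) ,
    (begin
      T (suc (suc n)) h
        ≡⟨ T-step-h n ⟩
      ℤ.- (+ 5 ℤ.* T (suc n) g) ℤ.- T n h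
        ≡⟨ cong₂ (λ x y → ℤ.- (+ 5 ℤ.* x) ℤ.- y) eg oh ⟩
      ℤ.- (+ 5 ℤ.* ℤ.- (h 0 ℤ.* + fib (suc n))) ℤ.- h 0 ℤ.* + luc n
        ≡⟨ lemma₂ (h 0) (+ fib (suc n)) (+ luc n) ⟩
      h 0 ℤ.* (+ 5 ℤ.* + fib (suc n) ℤ.- + luc n)
        ≡⟨ cong (h 0 ℤ.*_) 5fib-luc ⟩
      h 0 ℤ.* + luc (suc (suc n)) ∎)
    where
    lemma₁ : ∀ x f l → ℤ.- ℤ.- (+ 5 ℤ.* x ℤ.* f) ℤ.- x ℤ.* l ≡ x ℤ.* (+ 5 ℤ.* f ℤ.- l)
    lemma₁ = ℤ-Ring.solve-∀
    lemma₂ : ∀ x f l → ℤ.- (+ 5 ℤ.* ℤ.- (x ℤ.* f)) ℤ.- x ℤ.* l ≡ x ℤ.* (+ 5 ℤ.* f ℤ.- l)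
    lemma₂ = ℤ-Ring.solve-∀
    lemma₃ : ∀ x y → (x ℤ.+ + 2 ℤ.* y) ℤ.- y ≡ x ℤ.+ y
    lemma₃ = ℤ-Ring.solve-∀
    5fib-luc : + 5 ℤ.* + fib (suc n) ℤ.- + luc n ≡ + luc (suc (suc n))
    5fib-luc = begin
      + 5 ℤ.* + fib (suc n) ℤ.- + luc n
        ≡⟨ cong (ℤ._- + luc n) (trans (sym (ℤ.pos-* 5 (fib (suc n)))) (cong +_ (5fib≡luc+2luc n))) ⟩
      + (luc (suc n) ℕ.+ 2 ℕ.* luc n) ℤ.- + luc n
        ≡⟨ cong (λ x → (+ luc (suc n) ℤ.+ x) ℤ.- + luc n) (ℤ.pos-* 2 (luc n)) ⟩
      (+ luc (suc n) ℤ.+ + 2 ℤ.* + luc n) ℤ.- + luc n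
        ≡⟨ lemma₃ (+ luc (suc n)) (+ luc n) ⟩
      + luc (suc (suc n)) ∎

  -- Both components reduce to Lₙ₊₁ - Fₙ = Fₙ₊₂.
  even-step : ∀ n → OddForm g h (suc n) → EvenForm g h n → EvenForm g h (suc (suc n))
  even-step n (og , oh) (eg , eh) =
    (begin
      T (suc (suc n)) g
        ≡⟨ T-step-g n ⟩
      ℤ.- T (suc n) h ℤ.- T n g
        ≡⟨ cong₂ (λ x y → ℤ.- x ℤ.- y) oh eg ⟩
      ℤ.- (h 0 ℤ.* + luc (suc n)) ℤ.- ℤ.- (h 0 ℤ.* + fib n)
        ≡⟨ lemma₁ (h 0) (+ luc (suc n)) (+ fib n) ⟩
      ℤ.- (h 0 ℤ.* (+ luc (suc n) ℤ.- + fib n))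
        ≡⟨ cong (λ x → ℤ.- (h 0 ℤ.* x)) luc-fib ⟩
      ℤ.- (h 0 ℤ.* + fib (suc (suc n))) ∎) ,
    (begin
      T (suc (suc n)) h
        ≡⟨ T-step-h n ⟩
      ℤ.- (+ 5 ℤ.* T (suc n) g) ℤ.- T n h
        ≡⟨ cong₂ (λ x y → ℤ.- (+ 5 ℤ.* x) ℤ.- y) og eh ⟩
      ℤ.- (+ 5 ℤ.* (g 0 ℤ.* + luc (suc n))) ℤ.- ℤ.- (+ 5 ℤ.* g 0 ℤ.* + fib n)
        ≡⟨ lemma₂ (g 0) (+ luc (suc n)) (+ fib n) ⟩
      ℤ.- (+ 5 ℤ.* g 0 ℤ.* (+ luc (suc n) ℤ.- + fib n))
        ≡⟨ cong (λ x → ℤ.- (+ 5 ℤ.* g 0 ℤ.* x)) luc-fib ⟩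
      ℤ.- (+ 5 ℤ.* g 0 ℤ.* + fib (suc (suc n))) ∎)
    where
    lemma₁ : ∀ x l f → ℤ.- (x ℤ.* l) ℤ.- ℤ.- (x ℤ.* f) ≡ ℤ.- (x ℤ.* (l ℤ.- f))
    lemma₁ = ℤ-Ring.solve-∀
    lemma₂ : ∀ x l f → ℤ.- (+ 5 ℤ.* (x ℤ.* l)) ℤ.- ℤ.- (+ 5 ℤ.* x ℤ.* f)
                     ≡ ℤ.- (+ 5 ℤ.* x ℤ.* (l ℤ.- f))
    lemma₂ = ℤ-Ring.solve-∀
    lemma₃ : ∀ x y → (x ℤ.+ + 2 ℤ.* y) ℤ.- y ≡ x ℤ.+ y
    lemma₃ = ℤ-Ring.solve-∀
    luc-fib : + luc (suc n) ℤ.- + fib n ≡ + fib (suc (suc n))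
    luc-fib = begin
      + luc (suc n) ℤ.- + fib n
        ≡⟨ cong (λ x → + x ℤ.- + fib n) (luc≡fib+2fib n) ⟩
      + (fib (suc n) ℕ.+ 2 ℕ.* fib n) ℤ.- + fib n
        ≡⟨ cong (λ x → (+ fib (suc n) ℤ.+ x) ℤ.- + fib n) (ℤ.pos-* 2 (fib n)) ⟩
      (+ fib (suc n) ℤ.+ + 2 ℤ.* + fib n) ℤ.- + fib n
        ≡⟨ lemma₃ (+ fib (suc n)) (+ fib n) ⟩
      + fib (suc (suc n)) ∎

  -- Two-step induction in which each form at n + 2 comes from the opposite form at n + 1 and the
  -- same form at n.
  T-closed : ∀ n → (2 ∤ n → OddForm g h n) × (2 ∣ n → EvenForm g h n)
  T-closed 0 = (λ 2∤0 → contradiction (2 ∣0) 2∤0) , λ _ → zero-form (h 0) , zero-form′ (g 0)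
    where
    zero-form : ∀ x → 0ℤ ≡ ℤ.- (x ℤ.* 0ℤ)
    zero-form = ℤ-Ring.solve-∀
    zero-form′ : ∀ x → 0ℤ ≡ ℤ.- (+ 5 ℤ.* x ℤ.* 0ℤ)
    zero-form′ = ℤ-Ring.solve-∀
  T-closed 1 = (λ _ → one-form (g 0) , one-form (h 0)) , λ 2∣1 → contradiction (∣1⇒≡1 2∣1) λ ()
    where
    one-form : ∀ x → 0ℤ ℤ.+ + 1 ℤ.* x ≡ x ℤ.* + 1
    one-form = ℤ-Ring.solve-∀
  T-closed (suc (suc n)) =
    (λ 2∤2+n → let 2∤n = 2∤2+n ∘ ∣m∣n⇒∣m+n ∣-refl in
       odd-step n (proj₂ (T-closed (suc n)) (2∤n⇒2∣1+n n 2∤n)) (proj₁ (T-closed n) 2∤n)) ,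
    (λ 2∣2+n →
       even-step n (proj₁ (T-closed (suc n)) (2∣1+n⇒2∤n (suc n) 2∣2+n))
                   (proj₂ (T-closed n) (∣m+n∣m⇒∣n 2∣2+n ∣-refl)))

-- Rational coefficients

-- Arithmetic in `ℚ` reduces to lowest terms; carried over to `ℚᵘ`, it leaves plain fractions that
-- can be compared by cross-multiplication.
fromℚᵘ-homo-* : ∀ p q → fromℚᵘ (p ℚᵘ.* q) ≡ fromℚᵘ p * fromℚᵘ q
fromℚᵘ-homo-* p q = ℚ.toℚᵘ-injective
  (ℚᵘ.≃-trans (ℚ.toℚᵘ-fromℚᵘ (p ℚᵘ.* q))
    (ℚᵘ.≃-sym (ℚᵘ.≃-trans (ℚ.toℚᵘ-homo-* (fromℚᵘ p) (fromℚᵘ q))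
      (ℚᵘ.*-cong (ℚ.toℚᵘ-fromℚᵘ p) (ℚ.toℚᵘ-fromℚᵘ q)))))

fromℚᵘ-homo-+ : ∀ p q → fromℚᵘ (p ℚᵘ.+ q) ≡ fromℚᵘ p ℚ.+ fromℚᵘ q
fromℚᵘ-homo-+ p q = ℚ.toℚᵘ-injective
  (ℚᵘ.≃-trans (ℚ.toℚᵘ-fromℚᵘ (p ℚᵘ.+ q))
    (ℚᵘ.≃-sym (ℚᵘ.≃-trans (ℚ.toℚᵘ-homo-+ (fromℚᵘ p) (fromℚᵘ q))
      (ℚᵘ.+-cong (ℚ.toℚᵘ-fromℚᵘ p) (ℚ.toℚᵘ-fromℚᵘ q)))))

fromℤ-homo-* : ∀ i j → fromℤ (i ℤ.* j) ≡ fromℤ i * fromℤ j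
fromℤ-homo-* i j = fromℚᵘ-homo-* (mkℚᵘ i 0) (mkℚᵘ j 0)

fromℤ-homo-+ : ∀ i j → fromℤ (i ℤ.+ j) ≡ fromℤ i ℚ.+ fromℤ j
fromℤ-homo-+ i j = trans
  -- The sum of i/1 and j/1 in `ℚᵘ` has numerator i · 1 + j · 1.
  (cong fromℤ (sym (cong₂ ℤ._+_ (ℤ.*-identityʳ i) (ℤ.*-identityʳ j))))
  (fromℚᵘ-homo-+ (mkℚᵘ i 0) (mkℚᵘ j 0))

-- Symmetry replaces the lower index n - (k + 1) by 2k + 2, and absorption lowers it to 2k + 1. The
-- factor 2 makes the multiplier k + 1 into 2k + 2.
binomial-absorption : ∀ n k → k < n →
  2 ℕ.* (suc k ℕ.* ((n ℕ.+ suc k) C (n ℕ.∸ suc k))) ≡ suc (n ℕ.+ k) ℕ.* odd-C n k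
binomial-absorption n k k<n = begin
  2 ℕ.* (suc k ℕ.* ((n ℕ.+ suc k) C (n ℕ.∸ suc k)))
    ≡⟨ ℕ.*-assoc 2 (suc k) _ ⟨
  2 ℕ.* suc k ℕ.* ((n ℕ.+ suc k) C (n ℕ.∸ suc k))
    ≡⟨ cong (2 ℕ.* suc k ℕ.*_) symmetric ⟩
  2 ℕ.* suc k ℕ.* ((n ℕ.+ suc k) C (2 ℕ.* suc k))
    ≡⟨ cong₂ (λ i j → j ℕ.* (i C j)) (ℕ.+-suc n k) (ℕ.*-suc 2 k) ⟩
  suc (suc (2 ℕ.* k)) ℕ.* (suc (n ℕ.+ k) C suc (suc (2 ℕ.* k)))
    ≡⟨ [1+k]*[1+n]C[1+k]≡[1+n]*nCk (n ℕ.+ k) (suc (2 ℕ.* k)) ⟩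
  suc (n ℕ.+ k) ℕ.* odd-C n k ∎
  where
  symmetric : (n ℕ.+ suc k) C (n ℕ.∸ suc k) ≡ (n ℕ.+ suc k) C (2 ℕ.* suc k)
  symmetric = begin
    (n ℕ.+ suc k) C (n ℕ.∸ suc k)
      ≡⟨ nCk≡nC[n∸k] (ℕ.≤-trans (ℕ.m∸n≤m n (suc k)) (ℕ.m≤m+n n (suc k))) ⟩
    (n ℕ.+ suc k) C (n ℕ.+ suc k ℕ.∸ (n ℕ.∸ suc k))
      ≡⟨ cong ((n ℕ.+ suc k) C_) (ℕ.+-∸-comm (suc k) (ℕ.m∸n≤m n (suc k))) ⟩
    (n ℕ.+ suc k) C (n ℕ.∸ (n ℕ.∸ suc k) ℕ.+ suc k)
      -- Here `k < n` makes the truncated subtraction a true difference.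
      ≡⟨ cong (λ x → (n ℕ.+ suc k) C (x ℕ.+ suc k)) (ℕ.m∸[m∸n]≡n k<n) ⟩
    (n ℕ.+ suc k) C (suc k ℕ.+ suc k)
      ≡⟨ cong (λ x → (n ℕ.+ suc k) C (suc k ℕ.+ x)) (ℕ.+-identityʳ (suc k)) ⟨
    (n ℕ.+ suc k) C (2 ℕ.* suc k) ∎

coefficient≡½odd-C : ∀ n k → k < n →
  coefficient n (suc k) ≡ ½ * fromℤ (-1ℤ ℤ.^ k ℤ.* + odd-C n k)
coefficient≡½odd-C n k k<n = begin
  coefficient n (suc k)
    ≡⟨ cong (λ x → fromℤ s * x * fromℤ (+ b))
         (ℚ./-cong {+ suc k} {{n+k≢0 n (suc k)}} refl (ℕ.+-suc n k)) ⟩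
  fromℚᵘ s′ * fromℚᵘ k/n+k * fromℚᵘ b′
    ≡⟨ cong (_* fromℚᵘ b′) (fromℚᵘ-homo-* s′ k/n+k) ⟨
  fromℚᵘ (s′ ℚᵘ.* k/n+k) * fromℚᵘ b′
    ≡⟨ fromℚᵘ-homo-* (s′ ℚᵘ.* k/n+k) b′ ⟨
  fromℚᵘ (s′ ℚᵘ.* k/n+k ℚᵘ.* b′)
    -- `mkℚᵘ` stores the denominator less one, so `mkℚᵘ (+ 1) 1` is one half. After
    -- cross-multiplication the claim is `binomial-absorption` with a sign.
    ≡⟨ ℚ.fromℚᵘ-cong {s′ ℚᵘ.* k/n+k ℚᵘ.* b′}
         {mkℚᵘ (+ 1) 1 ℚᵘ.* mkℚᵘ (s ℤ.* + c) 0} (*≡* cross) ⟩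
  fromℚᵘ (mkℚᵘ (+ 1) 1 ℚᵘ.* mkℚᵘ (s ℤ.* + c) 0)
    ≡⟨ fromℚᵘ-homo-* (mkℚᵘ (+ 1) 1) (mkℚᵘ (s ℤ.* + c) 0) ⟩
  ½ * fromℤ (s ℤ.* + c) ∎
  where
  s = -1ℤ ℤ.^ k
  b = (n ℕ.+ suc k) C (n ℕ.∸ suc k)
  c = odd-C n k
  s′ = mkℚᵘ s 0
  k/n+k = mkℚᵘ (+ suc k) (n ℕ.+ k)
  b′ = mkℚᵘ (+ b) 0
  lemma₁ : ∀ s x y → (s ℤ.* x ℤ.* y) ℤ.* + 2 ≡ s ℤ.* (+ 2 ℤ.* (x ℤ.* y))
  lemma₁ = ℤ-Ring.solve-∀
  lemma₂ : ∀ s x y → s ℤ.* (x ℤ.* y) ≡ (+ 1 ℤ.* (s ℤ.* y)) ℤ.* x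
  lemma₂ = ℤ-Ring.solve-∀
  denominator : ℚᵘ.↧ (s′ ℚᵘ.* k/n+k ℚᵘ.* b′) ≡ + suc (n ℕ.+ k)
  denominator = cong +_ (trans (ℕ.*-identityʳ _) (ℕ.*-identityˡ (suc (n ℕ.+ k))))
  cross : (s ℤ.* + suc k ℤ.* + b) ℤ.* + 2
        ≡ (+ 1 ℤ.* (s ℤ.* + c)) ℤ.* ℚᵘ.↧ (s′ ℚᵘ.* k/n+k ℚᵘ.* b′)
  cross = begin
    (s ℤ.* + suc k ℤ.* + b) ℤ.* + 2
      ≡⟨ lemma₁ s (+ suc k) (+ b) ⟩
    s ℤ.* (+ 2 ℤ.* (+ suc k ℤ.* + b))
      ≡⟨ cong (λ x → s ℤ.* (+ 2 ℤ.* x)) (ℤ.pos-* (suc k) b) ⟨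
    s ℤ.* (+ 2 ℤ.* + (suc k ℕ.* b))
      ≡⟨ cong (s ℤ.*_) (ℤ.pos-* 2 (suc k ℕ.* b)) ⟨
    s ℤ.* + (2 ℕ.* (suc k ℕ.* b))
      ≡⟨ cong (λ x → s ℤ.* + x) (binomial-absorption n k k<n) ⟩
    s ℤ.* + (suc (n ℕ.+ k) ℕ.* c)
      ≡⟨ cong (s ℤ.*_) (ℤ.pos-* (suc (n ℕ.+ k)) c) ⟩
    s ℤ.* (+ suc (n ℕ.+ k) ℤ.* + c)
      ≡⟨ lemma₂ s (+ suc (n ℕ.+ k)) (+ c) ⟩
    (+ 1 ℤ.* (s ℤ.* + c)) ℤ.* + suc (n ℕ.+ k)
      ≡⟨ cong ((+ 1 ℤ.* (s ℤ.* + c)) ℤ.*_) denominator ⟨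
    (+ 1 ℤ.* (s ℤ.* + c)) ℤ.* ℚᵘ.↧ (s′ ℚᵘ.* k/n+k ℚᵘ.* b′) ∎

-- The upper limit `m` is separate from `n` so that induction can lower it while the coefficients
-- keep their `n`. The shift from 1, ..., m to 0, ..., m - 1 puts `suc` into `g`.
Σ≡½∑< : ∀ n m → m ℕ.≤ n → (g : ℕ → ℤ) →
  Σ[1⋯ m ] (λ k → coefficient n k * fromℤ (g k)) ≡ ½ * fromℤ (∑< m (term (odd-C n) (g ∘ suc)))
Σ≡½∑< n zero    _   g = refl
Σ≡½∑< n (suc m) m<n g = begin
  Σ[1⋯ m ] (λ k → coefficient n k * fromℤ (g k)) ℚ.+ coefficient n (suc m) * fromℤ (g (suc m))
    ≡⟨ cong₂ ℚ._+_ (Σ≡½∑< n m (ℕ.<⇒≤ m<n) g)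
         (cong (_* fromℤ (g (suc m))) (coefficient≡½odd-C n m m<n)) ⟩
  ½ * fromℤ S ℚ.+ ½ * fromℤ c * fromℤ (g (suc m))
    ≡⟨ cong (½ * fromℤ S ℚ.+_) (trans (ℚ.*-assoc ½ (fromℤ c) _)
         (cong (½ *_) (sym (fromℤ-homo-* c (g (suc m)))))) ⟩
  ½ * fromℤ S ℚ.+ ½ * fromℤ (c ℤ.* g (suc m))
    ≡⟨ ℚ.*-distribˡ-+ ½ (fromℤ S) _ ⟨
  ½ * (fromℤ S ℚ.+ fromℤ (c ℤ.* g (suc m)))
    ≡⟨ cong (½ *_) (fromℤ-homo-+ S (c ℤ.* g (suc m))) ⟨
  ½ * fromℤ (S ℤ.+ c ℤ.* g (suc m)) ∎
  where
  S = ∑< m (term (odd-C n) (g ∘ suc))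
  c = -1ℤ ℤ.^ m ℤ.* + odd-C n m

½*fromℤ : ∀ i j → ½ * fromℤ (i ℤ.* j) ≡ ½ * fromℤ i * fromℤ j
½*fromℤ i j = trans (cong (½ *_) (fromℤ-homo-* i j)) (sym (ℚ.*-assoc ½ (fromℤ i) (fromℤ j)))

-- Summation formulas along the indices 3k + t

theorem17 : (n : ℕ) (t : ℤ) →
    let
    sumL : ℚ
    sumL = Σ[1⋯ n ] (λ k → coefficient n k * fromℤ (L (+ (3 ℕ.* k) ℤ.+ t)))
    sumF : ℚ
    sumF = Σ[1⋯ n ] (λ k → coefficient n k * fromℤ (F (+ (3 ℕ.* k) ℤ.+ t)))
    in
    ( (2 ∤ n → sumL ≡ ½ * fromℤ (L (t ℤ.+ + 3)) * fromℤ (L (+ n)))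
    × (2 ∣ n → sumL ≡ (ℤ.- (+ 5) / 2) * fromℤ (F (t ℤ.+ + 3)) * fromℤ (F (+ n))) )
    ×
    ( (2 ∤ n → sumF ≡ ½ * fromℤ (F (t ℤ.+ + 3)) * fromℤ (L (+ n)))
    × (2 ∣ n → sumF ≡ -½ * fromℤ (L (t ℤ.+ + 3)) * fromℤ (F (+ n))) )
theorem17 n t =
  ( (λ 2∤n → begin
      _                                   ≡⟨ Σ≡½∑< n n ℕ.≤-refl (λ k → L (index k)) ⟩
      ½ * fromℤ (T n h)                   ≡⟨ cong (λ x → ½ * fromℤ x) (proj₂ (proj₁ closed 2∤n)) ⟩
      ½ * fromℤ (h 0 ℤ.* L (+ n))         ≡⟨ cong (λ i → ½ * fromℤ (L i ℤ.* L (+ n))) index₀ ⟩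
      ½ * fromℤ (L (t ℤ.+ + 3) ℤ.* L (+ n))
        ≡⟨ ½*fromℤ (L (t ℤ.+ + 3)) (L (+ n)) ⟩
      _                                   ∎)
  , (λ 2∣n → begin
      _                                   ≡⟨ Σ≡½∑< n n ℕ.≤-refl (λ k → L (index k)) ⟩
      ½ * fromℤ (T n h)                   ≡⟨ cong (λ x → ½ * fromℤ x) (proj₂ (proj₂ closed 2∣n)) ⟩
      ½ * fromℤ (ℤ.- (+ 5 ℤ.* g 0 ℤ.* F (+ n)))
        ≡⟨ cong (λ i → ½ * fromℤ (ℤ.- (+ 5 ℤ.* F i ℤ.* F (+ n)))) index₀ ⟩
      ½ * fromℤ (ℤ.- (+ 5 ℤ.* F (t ℤ.+ + 3) ℤ.* F (+ n)))
        ≡⟨ cong (λ x → ½ * fromℤ x) (neg₅ (F (t ℤ.+ + 3)) (F (+ n))) ⟩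
      ½ * fromℤ (ℤ.- (+ 5) ℤ.* F (t ℤ.+ + 3) ℤ.* F (+ n))
        ≡⟨ ½*fromℤ (ℤ.- (+ 5) ℤ.* F (t ℤ.+ + 3)) (F (+ n)) ⟩
      ½ * fromℤ (ℤ.- (+ 5) ℤ.* F (t ℤ.+ + 3)) * fromℤ (F (+ n))
        -- The product `½ * fromℤ (ℤ.- (+ 5))` evaluates to -5/2.
        ≡⟨ cong (_* fromℤ (F (+ n))) (½*fromℤ (ℤ.- (+ 5)) (F (t ℤ.+ + 3))) ⟩
      _                                   ∎) )
  ,
  ( (λ 2∤n → begin
      _                                   ≡⟨ Σ≡½∑< n n ℕ.≤-refl (λ k → F (index k)) ⟩
      ½ * fromℤ (T n g)                   ≡⟨ cong (λ x → ½ * fromℤ x) (proj₁ (proj₁ closed 2∤n)) ⟩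
      ½ * fromℤ (g 0 ℤ.* L (+ n))         ≡⟨ cong (λ i → ½ * fromℤ (F i ℤ.* L (+ n))) index₀ ⟩
      ½ * fromℤ (F (t ℤ.+ + 3) ℤ.* L (+ n))
        ≡⟨ ½*fromℤ (F (t ℤ.+ + 3)) (L (+ n)) ⟩
      _                                   ∎)
  , (λ 2∣n → begin
      _                                   ≡⟨ Σ≡½∑< n n ℕ.≤-refl (λ k → F (index k)) ⟩
      ½ * fromℤ (T n g)                   ≡⟨ cong (λ x → ½ * fromℤ x) (proj₁ (proj₂ closed 2∣n)) ⟩
      ½ * fromℤ (ℤ.- (h 0 ℤ.* F (+ n)))
        ≡⟨ cong (λ i → ½ * fromℤ (ℤ.- (L i ℤ.* F (+ n)))) index₀ ⟩
      ½ * fromℤ (ℤ.- (L (t ℤ.+ + 3) ℤ.* F (+ n)))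
        ≡⟨ cong (λ x → ½ * fromℤ x) (neg₁ (L (t ℤ.+ + 3)) (F (+ n))) ⟩
      ½ * fromℤ (-1ℤ ℤ.* L (t ℤ.+ + 3) ℤ.* F (+ n))
        ≡⟨ ½*fromℤ (-1ℤ ℤ.* L (t ℤ.+ + 3)) (F (+ n)) ⟩
      ½ * fromℤ (-1ℤ ℤ.* L (t ℤ.+ + 3)) * fromℤ (F (+ n))
        ≡⟨ cong (_* fromℤ (F (+ n))) (½*fromℤ -1ℤ (L (t ℤ.+ + 3))) ⟩
      _                                   ∎) )
  where
  index : ℕ → ℤ
  index k = + (3 ℕ.* k) ℤ.+ t
  -- The transforms start at 0 and the sums at 1, so the index is advanced by one and `g 0`, `h 0`
  -- sit at t + 3.
  g h : ℕ → ℤ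
  g k = F (index (suc k))
  h k = L (index (suc k))
  index-suc : ∀ k → index (suc k) ≡ index k ℤ.+ + 3
  index-suc k = trans (cong (λ x → + x ℤ.+ t) (ℕ.*-suc 3 k)) (lemma (+ (3 ℕ.* k)) t)
    where
    lemma : ∀ x t → (+ 3 ℤ.+ x) ℤ.+ t ≡ (x ℤ.+ t) ℤ.+ + 3
    lemma = ℤ-Ring.solve-∀
  index₀ : index 1 ≡ t ℤ.+ + 3
  index₀ = ℤ.+-comm (+ 3) t
  neg₅ : ∀ x y → ℤ.- (+ 5 ℤ.* x ℤ.* y) ≡ ℤ.- (+ 5) ℤ.* x ℤ.* y
  neg₅ = ℤ-Ring.solve-∀
  neg₁ : ∀ x y → ℤ.- (x ℤ.* y) ≡ -1ℤ ℤ.* x ℤ.* y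
  neg₁ = ℤ-Ring.solve-∀
  closed : (2 ∤ n → OddForm g h n) × (2 ∣ n → EvenForm g h n)
  closed = T-closed g h
    (λ k → trans (cong F (index-suc (suc k))) (F[i+3]≡2F+L (index (suc k))))
    (λ k → trans (cong L (index-suc (suc k))) (L[i+3]≡2L+5F (index (suc k))))
    n
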